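{- EG proves (outer transitivity): for all points $a,b,c,d$, if $\mathbf{B}(a,b,c)$, $\mathbf{B}(b,c,d)$ and $b\#c$, then $\mathbf{B}(a,b,d)$ and $\mathbf{B}(a,c,d)$.
   Context: EG is the following first-order theory over intuitionistic predicate logic with equality. Variables range over points; the primitive relations are a ternary relation $\mathbf{B}(a,b,c)$ (strict betweenness) and a quaternary relation $E(a,b,c,d)$, written $ab=cd$. Abbreviations: $a\#b$ means $\exists e\,(\mathbf{B}(e,a,b)\lor\mathbf{B}(a,e,b)\lor\mathbf{B}(a,b,e))$; $\mathrm{T}(a,b,c)$ means $\neg(a\neq b\land b\neq c\land\neg\mathbf{B}(a,b,c))$; $Ray(a,b,x)$ means $\exists d\,(\mathbf{B}(d,a,b)\land\mathrm{T}(d,a,x))$; $R(a,b,c)$ means $\exists d\,(\mathbf{B}(a,b,d)\land ab=bd\land ac=dc\land a\#b\land c\#b\land a\#c)$; $apex(a,b,c)$ means $\exists u,v\,(Ray(b,a,u)\land Ray(b,c,v)\land bu=bv\land b\#u\land u\#v)$; $\angle abc\cong\angle ABC$ means $\exists u,v,U,V\,(Ray(b,a,u)\land Ray(b,c,v)\land Ray(B,A,U)\land Ray(B,C,V)\land bu=BU\land bv=BV\land uv=UV)$; $0<abc$ means $apex(a,b,c)\lor R(a,b,c)\lor\exists A,B,C\,(\angle abc\cong\angle ABC\land(R(B,A,C)\lor R(B,C,A)))$; $abc<\pi$ means $\exists d\,(\mathbf{B}(a,b,d)\land 0<dbc)$; $0<abc<\pi$ means both. Axioms: (congruence) $ab=ba$;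 $ab=pq\land ab=rs\to pq=rs$; $ab=cc\to a=b$; $\neg\neg\,ab=cd\to ab=cd$. (betweenness) $\neg\mathbf{B}(a,b,a)$; $\mathbf{B}(a,b,c)\to\mathbf{B}(c,b,a)$; $\mathbf{B}(a,b,d)\land\mathbf{B}(b,c,d)\to\mathbf{B}(a,b,c)$; $\mathbf{B}(a,b,d)\land\mathbf{B}(a,c,d)\land\neg\mathbf{B}(a,b,c)\land\neg\mathbf{B}(a,c,b)\to b=c$. (extension) $A\#B\land ab=AB\to\exists e\,(\mathrm{T}(a,b,e)\land be=cd)$; $A\#B\land ab=AB\land C\#D\land cd=CD\to\exists e\,(\mathbf{B}(a,b,e)\land be=cd)$. (five-segment) $a\#b\land\mathrm{T}(a,b,c)\land\mathrm{T}(A,B,C)\land ab=AB\land bc=BC\land ad=AD\land bd=BD\to cd=CD$. (inner Pasch) $\mathbf{B}(a,p,c)\land\mathbf{B}(b,q,c)\land(0<acb<\pi\lor 0<qpa<\pi)\to\exists x\,(\mathbf{B}(p,x,b)\land\mathbf{B}(a,x,q))$. (outer Pasch) $\mathbf{B}(a,p,c)\land\mathbf{B}(b,c,q)\land(0<baq<\pi\lor 0<abq<\pi)\to\exists x\,(\mathbf{B}(b,p,x)\land\mathbf{B}(a,x,q))$. (lower dimension) constants $\alpha,\beta,\gamma,c_1,\dots,c_4$ with $\alpha\beta=\beta\gamma$, $\alpha\beta=\alpha\gamma$, $\alpha\neq\beta$, $\mathbf{B}(\alpha,c_1,\beta)\land\alpha c_1=c_1\beta$, $\mathbf{B}(\alpha,c_2,\gamma)\land\alpha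 c_2=c_2\gamma$, $\mathbf{B}(\beta,c_3,\gamma)\land\beta c_3=c_3\gamma$, $\mathbf{B}(\beta,c_4,c_2)\land\mathbf{B}(\gamma,c_4,c_1)$. (line-circle) $\mathbf{B}(u,a,v)\land cu=pq\land cv=pq\land\mathbf{B}(u,c,v)\to\exists x,y\,(cx=pq\land cy=pq\land\mathbf{B}(x,a,y))$, and the same with $\mathrm{T}$ in place of $\mathbf{B}$ throughout. (circle-circle) $ca=pq\land\mathrm{T}(u,a,v)\land\mathrm{T}(u,C,v)\land Cu=PQ\land Cv=PQ\land cb=pq\land\mathbf{B}(C,w,b)\land Cw=PQ\to\exists e\,(ce=pq\land Ce=PQ)$. (Euclid 5) $pt=qt\land\mathbf{B}(p,t,q)\land st=rt\land\mathbf{B}(s,t,r)\land pr=qs\land\mathbf{B}(q,a,r)\to\exists e\,(\mathbf{B}(p,a,e)\land\mathbf{B}(s,q,e))$. Free variables are universally quantified. -}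

module Defs where

open import Data.Product using (Σ; ∃; ∃-syntax; _×_; _,_)
open import Data.Sum using (_⊎_)
open import Relation.Nullary using (¬_)
open import Relation.Binary.PropositionalEquality using (_≡_)

-- The theory EG, read semantically: a model consists of a type of points with
-- equality _≡_, a ternary relation Bt (strict betweenness B(a,b,c)) and a
-- quaternary relation Eq (Eq a b c d  means  ab = cd), satisfying the axioms
-- below.

module EGTheory (Point : Set)
                (Bt : Point → Point → Point → Set)
                (Eq : Point → Point → Point → Point → Set) where

  _≢_ : Point → Point → Set
  a ≢ b = ¬ (a ≡ b)

  _#_ : Point → Point → Set
  a # b = ∃[ e ] (Bt e a b ⊎ Bt a e b ⊎ Bt a b e)

  T : Point → Point → Point → Set
  T a b c = ¬ (a ≢ b × b ≢ c × ¬ Bt a b c)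

  Ray : Point → Point → Point → Set
  Ray a b x = ∃[ d ] (Bt d a b × T d a x)

  -- R(a,b,c): right angle at b
  R : Point → Point → Point → Set
  R a b c = ∃[ d ] (Bt a b d × Eq a b b d × Eq a c d c × a # b × c # b × a # c)

  apex : Point → Point → Point → Set
  apex a b c = ∃[ u ] ∃[ v ] (Ray b a u × Ray b c v × Eq b u b v × b # u × u # v)

  AngleCong : Point → Point → Point → Point → Point → Point → Set
  AngleCong a b c A B C =
    ∃[ u ] ∃[ v ] ∃[ U ] ∃[ V ]
      (Ray b a u × Ray b c v × Ray B A U × Ray B C V ×
       Eq b u B U × Eq b v B V × Eq u v U V)

  -- 0 < abc
  Pos : Point → Point → Point → Set
  Pos a b c = apex a b c ⊎ R a b c ⊎
    (∃[ A ] ∃[ B ] ∃[ C ] (AngleCong a b c A B C × (R B A C ⊎ R B C A)))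

  LtPi : Point → Point → Point → Set
  LtPi a b c = ∃[ d ] (Bt a b d × Pos d b c)

  PosLtPi : Point → Point → Point → Set
  PosLtPi a b c = Pos a b c × LtPi a b c

  record EGAxioms : Set where
    field
      eq-sym   : ∀ a b → Eq a b b a
      eq-trans : ∀ a b p q r s → Eq a b p q → Eq a b r s → Eq p q r s
      eq-null  : ∀ a b c → Eq a b c c → a ≡ b
      eq-stab  : ∀ a b c d → ¬ ¬ Eq a b c d → Eq a b c d
      b-irrefl : ∀ a b → ¬ Bt a b a
      b-sym    : ∀ a b c → Bt a b c → Bt c b a
      b-inner  : ∀ a b c d → Bt a b d → Bt b c d → Bt a b c
      b-conn   : ∀ a b c d → Bt a b d → Bt a c d → ¬ Bt a b c → ¬ Bt a c b → b ≡ c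
      ext-T    : ∀ a b c d A B → A # B → Eq a b A B → ∃[ e ] (T a b e × Eq b e c d)
      ext-B    : ∀ a b c d A B C D → A # B → Eq a b A B → C # D → Eq c d C D →
                 ∃[ e ] (Bt a b e × Eq b e c d)
      five-seg : ∀ a b c d A B C D → a # b → T a b c → T A B C →
                 Eq a b A B → Eq b c B C → Eq a d A D → Eq b d B D → Eq c d C D
      inner-pasch : ∀ a b c p q → Bt a p c → Bt b q c →
                    (PosLtPi a c b ⊎ PosLtPi q p a) →
                    ∃[ x ] (Bt p x b × Bt a x q)
      outer-pasch : ∀ a b c p q → Bt a p c → Bt b c q →
                    (PosLtPi b a q ⊎ PosLtPi a b q) →
                    ∃[ x ] (Bt b p x × Bt a x q)
      α β γ c₁ c₂ c₃ c₄ : Point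
      ld-1 : Eq α β β γ
      ld-2 : Eq α β α γ
      ld-3 : α ≢ β
      ld-4 : Bt α c₁ β × Eq α c₁ c₁ β
      ld-5 : Bt α c₂ γ × Eq α c₂ c₂ γ
      ld-6 : Bt β c₃ γ × Eq β c₃ c₃ γ
      ld-7 : Bt β c₄ c₂ × Bt γ c₄ c₁
      line-circle-B : ∀ u a v c p q → Bt u a v → Eq c u p q → Eq c v p q → Bt u c v →
                      ∃[ x ] ∃[ y ] (Eq c x p q × Eq c y p q × Bt x a y)
      line-circle-T : ∀ u a v c p q → T u a v → Eq c u p q → Eq c v p q → T u c v →
                      ∃[ x ] ∃[ y ] (Eq c x p q × Eq c y p q × T x a y)
      circle-circle : ∀ c a p q u v C P Q b w →
                      Eq c a p q → T u a v → T u C v → Eq C u P Q → Eq C v P Q →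
                      Eq c b p q → Bt C w b → Eq C w P Q →
                      ∃[ e ] (Eq c e p q × Eq C e P Q)
      euclid5 : ∀ p t q s r a → Eq p t q t → Bt p t q → Eq s t r t → Bt s t r →
                Eq p r q s → Bt q a r → ∃[ e ] (Bt p a e × Bt s q e)

module Submission where

-- Given B(a,b,c), B(b,c,d) and b # c, extend the segment ac beyond c
-- by the length cd, obtaining e with B(a,c,e) and ce = cd.  Inner
-- transitivity turns B(a,c,e) and B(a,b,c) into B(b,c,e), so d and e both
-- extend bc beyond c by the same length; by uniqueness of extension (a
-- consequence of the five-segment axiom) d = e, whence B(a,c,d).  This is
-- the "right half" of the theorem; the "left half" B(a,b,d) is the right half
-- applied to the reversed configuration B(d,c,b), B(c,b,a).

open import Defs
open import Data.Product using (_×_; _,_)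
open import Data.Sum using (inj₁; inj₂)
open import Relation.Binary.PropositionalEquality using (_≡_; sym; subst)

module OuterTransitivity
    (Point : Set)
    (Bt : Point → Point → Point → Set)
    (Eq : Point → Point → Point → Point → Set)
    (ax : EGTheory.EGAxioms Point Bt Eq) where
  open EGTheory Point Bt Eq
  open EGAxioms ax

  eq-refl : ∀ x y → Eq x y x y
  eq-refl x y = eq-trans y x x y x y (eq-sym y x) (eq-sym y x)

  eq-symm : ∀ {a b p q} → Eq a b p q → Eq p q a b
  eq-symm {a} {b} {p} {q} h = eq-trans a b p q a b h (eq-refl a b)

  Bt⇒T : ∀ {x y z} → Bt x y z → T x y z
  Bt⇒T xyz (_ , _ , ¬xyz) = ¬xyz xyz

  Bt⇒#-outer : ∀ {x y z} → Bt x y z → x # z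
  Bt⇒#-outer {y = y} xyz = y , inj₂ (inj₁ xyz)

  Bt⇒#-right : ∀ {x y z} → Bt x y z → y # z
  Bt⇒#-right {x = x} xyz = x , inj₁ xyz

  #-sym : ∀ {x y} → x # y → y # x
  #-sym {x} {y} (e , inj₁ exy)        = e , inj₂ (inj₂ (b-sym e x y exy))
  #-sym {x} {y} (e , inj₂ (inj₁ xey)) = e , inj₂ (inj₁ (b-sym x e y xey))
  #-sym {x} {y} (e , inj₂ (inj₂ xye)) = e , inj₁ (b-sym x y e xye)

  -- Five-segment applied to the configurations
  -- (b,c,d;d) and (b,c,d';d) yields dd = d'd, so d' = d by eq-null.
  extension-unique : ∀ b c d d' → b # c → Bt b c d → Bt b c d' →
                     Eq c d c d' → d ≡ d'
  extension-unique b c d d' b#c bcd bcd' cd=cd' = sym (eq-null d' d d d'd=dd)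
    where
      dd=d'd : Eq d d d' d
      dd=d'd = five-seg b c d d b c d' d b#c (Bt⇒T bcd) (Bt⇒T bcd')
                 (eq-refl b c) cd=cd' (eq-refl b d) (eq-refl c d)

      d'd=dd : Eq d' d d d
      d'd=dd = eq-trans d d d' d d d dd=d'd (eq-refl d d)

  outer-trans-right : ∀ a b c d → Bt a b c → Bt b c d → b # c → Bt a c d
  outer-trans-right a b c d abc bcd b#c
    with ext-B a c c d a c c d (Bt⇒#-outer abc) (eq-refl a c)
                               (Bt⇒#-right bcd) (eq-refl c d)
  ... | e , ace , ce=cd = subst (Bt a c) (sym d≡e) ace
    where
      -- inner transitivity on e–c–a with c–b–a places c between b and e
      bce : Bt b c e
      bce = b-sym e c b (b-inner e c b a (b-sym a c e ace) (b-sym a b c abc))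

      d≡e : d ≡ e
      d≡e = extension-unique b c d e b#c bcd bce (eq-symm ce=cd)

  outer-trans : ∀ a b c d → Bt a b c → Bt b c d → b # c → Bt a b d × Bt a c d
  outer-trans a b c d abc bcd b#c = abd , outer-trans-right a b c d abc bcd b#c
    where
      dba : Bt d b a
      dba = outer-trans-right d c b a (b-sym b c d bcd) (b-sym a b c abc) (#-sym b#c)

      abd : Bt a b d
      abd = b-sym d b a dba

lemma5p2 : (Point : Set)
           (Bt : Point → Point → Point → Set)
           (Eq : Point → Point → Point → Point → Set) →
           EGTheory.EGAxioms Point Bt Eq →
           ∀ a b c d → Bt a b c → Bt b c d → EGTheory._#_ Point Bt Eq b c →
           Bt a b d × Bt a c d
lemma5p2 Point Bt Eq ax = OuterTransitivity.outer-trans Point Bt Eq ax
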